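{- For all $n\ge1$, $$h_n=\frac52nH_n+\frac32P_n-2H_n,\qquad p_n=\frac52nP_n-\frac32P_n=\frac{5n-3}{2}P_n.$$
   Context: Let $s=\sqrt3/2$. Consider the standard triangular lattice in the plane whose vertices are the points $(a+b/2,\,bs)$ with $a,b\in\mathbb Z$ and whose edges are the unit segments joining lattice points in the directions $0^\circ,60^\circ,120^\circ$; it divides the plane into unit equilateral triangles called cells. A small tile is a single cell; a large tile is an equilateral triangle of side $2$ whose vertices are lattice points (so it is a union of $4$ cells; it may point up or down). For a region $R$ that is a finite union of cells, a tiling of $R$ is a finite set of small and large tiles, each contained in $R$, with pairwise disjoint interiors and union equal to $R$. For $n\ge1$, the region $H_n$ is the union of the trapezoid with vertices $(0,0),(n,0),(n-\tfrac12,s),(\tfrac12,s)$ and the trapezoid with vertices $(\tfrac12,s),(n-\tfrac12,s),(n,2s),(0,2s)$ ($4n-2$ cells; for $n=1$ two unit triangles meeting at a point), and $P_n$ is $H_n$ with the cell with vertices $(n-1,0),(n,0),(n-\tfrac12,s)$ removed. $H_n$ and $P_n$ also denote the numbers of tilings of these regions; thus $H_n=\frac{(1+\sqrt2)^n+(1-\sqrt2)^n}{2}$ and $P_n=\frac{(1+\sqrt2)^n-(1-\sqrt2)^n}{2\sqrt2}$. Define $h_n$ (resp. $p_n$) as the sum, over all tilings of $H_n$ (resp. $P_n$), of the total number of tiles in the tiling. -}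

module Defs where

open import Data.Integer.Base as ℤ using (ℤ; +_; 0ℤ; 1ℤ)
import Data.Integer.Properties as ℤ
open import Data.List.Base using (List; []; _∷_; _++_; map; concatMap; filter; length; upTo)
open import Data.List.Relation.Unary.All using (All; all?)
open import Data.List.Relation.Unary.AllPairs using (AllPairs; allPairs?)
open import Data.Nat.Base using (ℕ; suc; _∸_)
open import Data.Nat.ListAction using (sum)
open import Data.Product.Base using (_×_; _,_)
open import Data.Rational.Base using (ℚ; _/_)
open import Relation.Binary.Definitions using (DecidableEquality)
open import Relation.Binary.PropositionalEquality using (refl)
open import Relation.Nullary using (Dec; yes; no; ¬?; _×-dec_)
open import Relation.Nullary.Decidable using (map′)

-- The pair (a , b) of integers stands for the lattice point
-- (a + b/2 , b·√3/2) of the plane.  In these lattice coordinates,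
--   up   a b  is the cell with vertices (a , b), (a+1 , b), (a , b+1);
--   down a b  is the cell with vertices (a , b), (a , b+1), (a-1 , b+1),
-- so that (a , b) is the left end of the base of an up cell, and the bottom
-- vertex of a down cell.
data Cell : Set where
  up down : (a b : ℤ) → Cell

infix 4 _≟_

_≟_ : DecidableEquality Cell
up a b   ≟ up c d   = map′ (λ { (refl , refl) → refl }) (λ { refl → refl , refl })
                           (a ℤ.≟ c ×-dec b ℤ.≟ d)
up _ _   ≟ down _ _ = no λ ()
down _ _ ≟ up _ _   = no λ ()
down a b ≟ down c d = map′ (λ { (refl , refl) → refl }) (λ { refl → refl , refl })
                           (a ℤ.≟ c ×-dec b ℤ.≟ d)

open import Data.List.Relation.Binary.Disjoint.DecPropositional _≟_ using (Disjoint; disjoint?)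
open import Data.List.Relation.Binary.Subset.DecPropositional _≟_ using (_⊆_; _⊆?_)

-- A finite union of cells, given by the cells it contains.
Region : Set
Region = List Cell

-- large c is the triangle of side 2 with the orientation of c and the same
-- lattice point (a , b) as its lower left, respectively bottom, vertex:
--   large (up   a b)  has vertices (a , b), (a+2 , b), (a , b+2);
--   large (down a b)  has vertices (a , b), (a , b+2), (a-2 , b+2).
data Tile : Set where
  small large : Cell → Tile

cells : Tile → Region
cells (small c)          = c ∷ []
cells (large (up a b))   = up a b ∷ up (ℤ.suc a) b ∷ up a (ℤ.suc b) ∷ down (ℤ.suc a) b ∷ []
cells (large (down a b)) =
  down a b ∷ down a (ℤ.suc b) ∷ down (ℤ.pred a) (ℤ.suc b) ∷ up (ℤ.pred a) (ℤ.suc b) ∷ []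

-- Two unions of cells have disjoint interiors iff they have no cell in common.
IsTiling : Region → List Tile → Set
IsTiling R ts =
  All (λ t → cells t ⊆ R) ts
  × AllPairs (λ t u → Disjoint (cells t) (cells u)) ts
  × R ⊆ concatMap cells ts

isTiling? : ∀ R ts → Dec (IsTiling R ts)
isTiling? R ts =
  all? (λ t → cells t ⊆? R) ts
  ×-dec allPairs? (λ t u → disjoint? (cells t) (cells u)) ts
  ×-dec R ⊆? concatMap cells ts

sublists : ∀ {A : Set} → List A → List (List A)
sublists []       = [] ∷ []
sublists (x ∷ xs) = sublists xs ++ map (x ∷_) (sublists xs)

-- Since c is one of the cells of both small c and large c, every tile contained
-- in R occurs here.
candidates : Region → List Tile
candidates R = map small R ++ map large R

-- If R is listed without repetition, so is candidates R, and its sublists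
-- represent each finite set of candidate tiles exactly once.
tilings : Region → List (List Tile)
tilings R = filter (isTiling? R) (sublists (candidates R))

numTilings : Region → ℕ
numTilings R = length (tilings R)

totalTiles : Region → ℕ
totalTiles R = sum (map length (tilings R))

-- The trapezoid with vertices (0,0), (n,0), (n-1/2,s), (1/2,s), where s = √3/2;
-- in lattice coordinates (0 , 0), (n , 0), (n-1 , 1), (0 , 1).
lowerTrapezoid : ℕ → Region
lowerTrapezoid n =
  map (λ k → up (+ k) 0ℤ) (upTo n) ++ map (λ k → down (+ suc k) 0ℤ) (upTo (n ∸ 1))

-- The trapezoid with vertices (1/2,s), (n-1/2,s), (n,2s), (0,2s);
-- in lattice coordinates (0 , 1), (n-1 , 1), (n-1 , 2), (-1 , 2).
upperTrapezoid : ℕ → Region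
upperTrapezoid n =
  map (λ k → down (+ k) 1ℤ) (upTo n) ++ map (λ k → up (+ k) 1ℤ) (upTo (n ∸ 1))

regionH : ℕ → Region
regionH n = lowerTrapezoid n ++ upperTrapezoid n

-- The removed cell has vertices (n-1,0), (n,0), (n-1/2,s).
regionP : ℕ → Region
regionP n = filter (λ c → ¬? (c ≟ up (+ n ℤ.- 1ℤ) 0ℤ)) (regionH n)

H P h p : ℕ → ℕ
H n = numTilings (regionH n)
P n = numTilings (regionP n)
h n = totalTiles (regionH n)
p n = totalTiles (regionP n)

toℚ : ℕ → ℚ
toℚ n = + n / 1

{-# OPTIONS --safe #-}

-- The large tiles of a tiling can be any pairwise disjoint large tiles contained
-- in the region, and they determine the tiling, since the remaining cells must be
-- small tiles.  So a tiling of R with k large tiles has |R| - 3k tiles, and it is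
-- enough to count the packings by large tiles and the large tiles in them.
--
-- Put n = m + 1.  The large tiles contained in H_n are, for k < m, an upward one
-- U_k and a downward one D_k; only U_k and D_k, U_k and U_(k+1), D_k and D_(k+1)
-- overlap, and P_n loses U_(m-1).  Removing the last tiles D_m, U_m one by one
-- yields linear recurrences for the numbers H, P of packings and the total numbers
-- T_H, T_P of large tiles in them, and 2 T_P = m P and 2 T_H + P = (m + 1) H
-- follow by simultaneous induction on m.
module Submission where

open import Defs
open import Data.Bool.Base using (if_then_else_; true; false)
open import Data.Integer.Base as ℤ using (0ℤ; 1ℤ)
import Data.Integer.Properties as ℤ
open import Data.List.Base using (List; []; _∷_; _++_; map; concatMap; filter; length; upTo)
open import Data.List.Membership.DecPropositional _≟_ using (_∈?_)
open import Data.List.Membership.Propositional using (_∈_; _∉_; find; lose)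
open import Data.List.Membership.Propositional.Properties
open import Data.List.Membership.Propositional.Properties.WithK using (unique∧set⇒bag)
open import Data.List.Properties
  using ( ∷-injectiveʳ; map-++; map-cong; map-cong-local; map-∘; length-++; length-map; length-upTo
        ; concatMap-++; concatMap-map; concatMap-pure; filter-all; filter-accept; filter-reject )
open import Data.List.Relation.Binary.BagAndSetEquality using (∼bag⇒↭)
open import Data.List.Relation.Binary.Disjoint.DecPropositional _≟_ using (Disjoint; disjoint?)
open import Data.List.Relation.Binary.Permutation.Propositional as Perm using (_↭_; ↭⇒↭ₛ)
open import Data.List.Relation.Binary.Permutation.Propositional.Properties using (↭-length)
import Data.List.Relation.Binary.Permutation.Setoid.Properties as PermSetoid
open import Data.List.Relation.Binary.Sublist.Propositional as Sublist
  using () renaming (_⊆_ to _⊑_)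
open import Data.List.Relation.Binary.Sublist.Propositional.Properties using (All-resp-⊆)
open import Data.List.Relation.Binary.Subset.DecPropositional _≟_ using (_⊆_; _⊆?_)
open import Data.List.Relation.Binary.Subset.Propositional.Properties using (filter-⊆)
open import Data.List.Relation.Unary.All as All using (All; []; _∷_)
import Data.List.Relation.Unary.All.Properties as All
open import Data.List.Relation.Unary.AllPairs as AllPairs using (AllPairs; []; _∷_; allPairs?)
import Data.List.Relation.Unary.AllPairs.Properties as AllPairs
open import Data.List.Relation.Unary.Any using (here; there)
open import Data.List.Relation.Unary.Unique.Propositional using (Unique)
open import Data.List.Relation.Unary.Unique.Propositional.Properties as Unique
  using (Unique[x∷xs]⇒x∉xs)
import Data.Nat.Base as ℕ
open import Data.Nat.Base using (ℕ; zero; suc; _∸_; _≤_; _<_; _≥_; s≤s⁻¹; s<s; s<s⁻¹)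
open import Data.Nat.ListAction using (sum)
open import Data.Nat.ListAction.Properties using (sum-++)
open import Data.Nat.Properties
  using ( +-suc; +-identityʳ; +-cancelʳ-≡; *-identityʳ; *-zeroʳ; *-distribˡ-+; suc-injective; 1+n≢n
        ; ≤-refl; ≤-trans; <-irrefl; <-≤-trans; <⇒≱; ≤∧≢⇒<; n≤1+n; n<1+n; m∸n≤m; m<n⇒m<1+n
        ; m<1+n⇒m<n∨m≡n )
open import Data.Nat.Tactic.RingSolver using (solve-∀)
open import Data.Product.Base using (_×_; _,_; proj₁; proj₂)
import Data.Rational.Base as ℚ
open ℚ using (toℚᵘ)
import Data.Rational.Properties as ℚ
open import Data.Rational.Solver using (module +-*-Solver)
open import Data.Rational.Unnormalised.Base as ℚᵘ using (mkℚᵘ; *≡*)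
import Data.Rational.Unnormalised.Properties as ℚᵘ
open import Data.Sum.Base using (_⊎_; inj₁; inj₂; [_,_])
open import Function.Base using (_∘_; const; id)
open import Function.Bundles using (_⇔_; mk⇔; Equivalence)
open import Relation.Binary.PropositionalEquality hiding ([_])
open import Relation.Nullary using (Dec; yes; no; ¬_; ¬?; contradiction; does)
open import Relation.Nullary.Decidable using (dec-false; does-⇔)
open import Relation.Unary using (Decidable)

-- Keeps the operators _+_ and _*_ of ℕ local: at the end they are those of ℚ.
module _ where

  open import Data.Nat.Base using (_+_; _*_)

  -- Sums with decidable conditions

  private
    variable
      A B : Set
      X Y : Set

  -- Depends only on the Boolean of the decision, so deciders of equivalent conditions give equal
  -- weights. A filtered sum thus becomes a sum over all sublists, which can be split and regrouped.
  weight : Dec X → ℕ → ℕ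
  weight X? k = if does X? then k else 0

  weight-no : (X? : Dec X) → ¬ X → ∀ k → weight X? k ≡ 0
  weight-no X? ¬x k rewrite dec-false X? ¬x = refl

  weight-⇔ : (X? : Dec X) (Y? : Dec Y) → X ⇔ Y → ∀ k → weight X? k ≡ weight Y? k
  weight-⇔ X? Y? X⇔Y k = cong (λ b → if b then k else 0) (does-⇔ X⇔Y X? Y?)

  sum-map-filter : {P : A → Set} (P? : Decidable P) (g : A → ℕ) → ∀ xs →
                   sum (map g (filter P? xs)) ≡ sum (map (λ x → weight (P? x) (g x)) xs)
  sum-map-filter P? g [] = refl
  sum-map-filter P? g (x ∷ xs) with does (P? x)
  ... | true  = cong (g x +_) (sum-map-filter P? g xs)
  ... | false = sum-map-filter P? g xs

  length≡sum : (xs : List A) → length xs ≡ sum (map (const 1) xs)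
  length≡sum []       = refl
  length≡sum (_ ∷ xs) = cong suc (length≡sum xs)

  length-filter-filter : {P Q : A → Set} (P? : Decidable P) (Q? : Decidable Q) →
    (∀ {x} → Q x ⇔ (¬ P x)) → ∀ xs → length (filter P? xs) + length (filter Q? xs) ≡ length xs
  length-filter-filter P? Q? Q⇔¬P [] = refl
  length-filter-filter P? Q? Q⇔¬P (x ∷ xs) with P? x | Q? x
  ... | yes p | yes q = contradiction p (Equivalence.to Q⇔¬P q)
  ... | yes p | no _  = cong suc (length-filter-filter P? Q? Q⇔¬P xs)
  ... | no _  | yes q = trans (+-suc _ _) (cong suc (length-filter-filter P? Q? Q⇔¬P xs))
  ... | no ¬p | no ¬q = contradiction (Equivalence.from Q⇔¬P ¬p) ¬q

  -- Sums over all sublists of a list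

  ∈-sublists⇒⊑ : ∀ (xs : List A) {s} → s ∈ sublists xs → s ⊑ xs
  ∈-sublists⇒⊑ [] (here refl) = Sublist.[]
  ∈-sublists⇒⊑ (x ∷ xs) s∈ with ∈-++⁻ (sublists xs) s∈
  ... | inj₁ s∈xs = x Sublist.∷ʳ ∈-sublists⇒⊑ xs s∈xs
  ... | inj₂ s∈map with ∈-map⁻ (x ∷_) s∈map
  ... | t , t∈xs , refl = refl Sublist.∷ ∈-sublists⇒⊑ xs t∈xs

  sublistSum : (List A → ℕ) → List A → ℕ
  sublistSum f xs = sum (map f (sublists xs))

  sublistSum-∷ : ∀ (f : List A → ℕ) x xs →
                 sublistSum f (x ∷ xs) ≡ sublistSum f xs + sublistSum (f ∘ (x ∷_)) xs
  sublistSum-∷ f x xs = begin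
    sum (map f (sublists xs ++ map (x ∷_) (sublists xs)))
      ≡⟨ cong sum (map-++ f (sublists xs) _) ⟩
    sum (map f (sublists xs) ++ map f (map (x ∷_) (sublists xs)))
      ≡⟨ sum-++ (map f (sublists xs)) _ ⟩
    sublistSum f xs + sum (map f (map (x ∷_) (sublists xs)))
      ≡⟨ cong (λ ys → sublistSum f xs + sum ys) (map-∘ (sublists xs)) ⟨
    sublistSum f xs + sublistSum (f ∘ (x ∷_)) xs ∎
    where open ≡-Reasoning

  sublistSum-cong : ∀ {f g : List A → ℕ} xs → (∀ {s} → s ⊑ xs → f s ≡ g s) →
                    sublistSum f xs ≡ sublistSum g xs
  sublistSum-cong xs f≗g =
    cong sum (map-cong-local (All.tabulate λ s∈ → f≗g (∈-sublists⇒⊑ xs s∈)))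

  sublistSum-+ : ∀ (f g : List A → ℕ) xs →
                 sublistSum (λ s → f s + g s) xs ≡ sublistSum f xs + sublistSum g xs
  sublistSum-+ f g []       = lemma (f []) (g [])
    where
    lemma : ∀ a b → a + b + 0 ≡ a + 0 + (b + 0)
    lemma = solve-∀
  sublistSum-+ f g (x ∷ xs)
    rewrite sublistSum-∷ (λ s → f s + g s) x xs | sublistSum-∷ f x xs | sublistSum-∷ g x xs
          | sublistSum-+ f g xs | sublistSum-+ (f ∘ (x ∷_)) (g ∘ (x ∷_)) xs
    = lemma (sublistSum f xs) (sublistSum g xs) _ _
    where
    lemma : ∀ a b c d → a + b + (c + d) ≡ a + c + (b + d)
    lemma = solve-∀

  sublistSum-* : ∀ k (f : List A → ℕ) xs → sublistSum (λ s → k * f s) xs ≡ k * sublistSum f xs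
  sublistSum-* k f []       = lemma k (f [])
    where
    lemma : ∀ k a → k * a + 0 ≡ k * (a + 0)
    lemma = solve-∀
  sublistSum-* k f (x ∷ xs)
    rewrite sublistSum-∷ (λ s → k * f s) x xs | sublistSum-∷ f x xs
          | sublistSum-* k f xs | sublistSum-* k (f ∘ (x ∷_)) xs
    = sym (*-distribˡ-+ k (sublistSum f xs) _)

  sublistSum-map : ∀ (h : A → B) (f : List B → ℕ) xs →
                   sublistSum f (map h xs) ≡ sublistSum (f ∘ map h) xs
  sublistSum-map h f []       = refl
  sublistSum-map h f (x ∷ xs)
    rewrite sublistSum-∷ f (h x) (map h xs) | sublistSum-∷ (f ∘ map h) x xs
    = cong₂ _+_ (sublistSum-map h f xs) (sublistSum-map h (f ∘ (h x ∷_)) xs)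

  -- Choosing a sublist of a concatenation means choosing one in each half independently. This later
  -- separates the choice of the small tiles from that of the large ones.
  sublistSum-++ : ∀ (f : List A → ℕ) xs ys →
    sublistSum f (xs ++ ys) ≡ sublistSum (λ t → sublistSum (λ s → f (s ++ t)) xs) ys
  sublistSum-++ f []       ys = cong sum (map-cong (λ t → sym (+-identityʳ (f t))) (sublists ys))
  sublistSum-++ f (x ∷ xs) ys = begin
    sublistSum f (x ∷ xs ++ ys)
      ≡⟨ sublistSum-∷ f x (xs ++ ys) ⟩
    sublistSum f (xs ++ ys) + sublistSum (f ∘ (x ∷_)) (xs ++ ys)
      ≡⟨ cong₂ _+_ (sublistSum-++ f xs ys) (sublistSum-++ (f ∘ (x ∷_)) xs ys) ⟩
    sublistSum (λ t → sublistSum (λ s → f (s ++ t)) xs) ys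
      + sublistSum (λ t → sublistSum (λ s → f (x ∷ s ++ t)) xs) ys
      ≡⟨ sublistSum-+ _ _ ys ⟨
    sublistSum (λ t → sublistSum (λ s → f (s ++ t)) xs + sublistSum (λ s → f (x ∷ s ++ t)) xs) ys
      ≡⟨ sublistSum-cong ys (λ {t} _ → sym (sublistSum-∷ (λ s → f (s ++ t)) x xs)) ⟩
    sublistSum (λ t → sublistSum (λ s → f (s ++ t)) (x ∷ xs)) ys ∎
    where open ≡-Reasoning

  sublistSum-zero : ∀ (f : List A → ℕ) xs → (∀ {s} → s ⊑ xs → f s ≡ 0) → sublistSum f xs ≡ 0
  -- Each zero is read as `0 * 0`, so that pulling out the factor `0` leaves a product that computes
  -- to zero.
  sublistSum-zero f xs f≡0 = trans (sublistSum-cong xs f≡0) (sublistSum-* 0 (const 0) xs)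

  -- A sublist with an entry violating `P` contributes nothing, so such entries can be deleted
  -- beforehand. Used to discard large tiles that leave the region or overlap a tile already taken.
  sublistSum-filter : {P : A → Set} (P? : Decidable P) (f : List A → ℕ) →
    (∀ {s} → ¬ All P s → f s ≡ 0) → ∀ xs → sublistSum f xs ≡ sublistSum f (filter P? xs)
  sublistSum-filter P? f f≡0 [] = refl
  sublistSum-filter P? f f≡0 (x ∷ xs) with P? x
  ... | yes px = begin
    sublistSum f (x ∷ xs)
      ≡⟨ sublistSum-∷ f x xs ⟩
    sublistSum f xs + sublistSum (f ∘ (x ∷_)) xs
      ≡⟨ cong₂ _+_ (sublistSum-filter P? f f≡0 xs)
                   (sublistSum-filter P? (f ∘ (x ∷_)) (λ ¬ps → f≡0 λ { (_ ∷ ps) → ¬ps ps }) xs) ⟩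
    sublistSum f (filter P? xs) + sublistSum (f ∘ (x ∷_)) (filter P? xs)
      ≡⟨ sublistSum-∷ f x (filter P? xs) ⟨
    sublistSum f (x ∷ filter P? xs) ∎
    where open ≡-Reasoning
  ... | no ¬px = begin
    sublistSum f (x ∷ xs)
      ≡⟨ sublistSum-∷ f x xs ⟩
    sublistSum f xs + sublistSum (f ∘ (x ∷_)) xs
      ≡⟨ cong (sublistSum f xs +_)
              (sublistSum-zero _ xs λ _ → f≡0 λ { (px ∷ _) → ¬px px }) ⟩
    sublistSum f xs + 0
      ≡⟨ +-identityʳ _ ⟩
    sublistSum f xs
      ≡⟨ sublistSum-filter P? f f≡0 xs ⟩
    sublistSum f (filter P? xs) ∎
    where open ≡-Reasoning

  -- Without repetitions in the list, `filter P? xs` arises from one choice of positions only: since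
  -- the head does not recur in the tail, the branch that treats the head the other way never
  -- produces it.
  sublistSum-single : {P : A → Set} (P? : Decidable P) (f : List A → ℕ) → ∀ {xs} → Unique xs →
    (∀ {s} → s ⊑ xs → s ≢ filter P? xs → f s ≡ 0) → sublistSum f xs ≡ f (filter P? xs)
  sublistSum-single P? f {[]} _ _ = +-identityʳ (f [])
  sublistSum-single P? f {x ∷ xs} uxs@(_ ∷ u) f≡0 with P? x
  ... | yes px = begin
    sublistSum f (x ∷ xs)
      ≡⟨ sublistSum-∷ f x xs ⟩
    sublistSum f xs + sublistSum (f ∘ (x ∷_)) xs
      ≡⟨ cong₂ _+_
           (sublistSum-zero f xs λ s⊑xs → f≡0 (x Sublist.∷ʳ s⊑xs)
              λ { refl → Unique[x∷xs]⇒x∉xs uxs (Sublist.lookup s⊑xs (here refl)) })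
           (sublistSum-single P? (f ∘ (x ∷_)) u λ s⊑xs s≢ →
              f≡0 (refl Sublist.∷ s⊑xs) (s≢ ∘ ∷-injectiveʳ)) ⟩
    f (x ∷ filter P? xs) ∎
    where open ≡-Reasoning
  ... | no ¬px = begin
    sublistSum f (x ∷ xs)
      ≡⟨ sublistSum-∷ f x xs ⟩
    sublistSum f xs + sublistSum (f ∘ (x ∷_)) xs
      ≡⟨ cong₂ _+_
           (sublistSum-single P? f u λ s⊑xs → f≡0 (x Sublist.∷ʳ s⊑xs))
           (sublistSum-zero _ xs λ s⊑xs → f≡0 (refl Sublist.∷ s⊑xs) λ x∷s≡ →
              Unique[x∷xs]⇒x∉xs uxs (filter-⊆ P? xs (subst (x ∈_) x∷s≡ (here refl)))) ⟩
    f (filter P? xs) + 0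
      ≡⟨ +-identityʳ _ ⟩
    f (filter P? xs) ∎
    where open ≡-Reasoning

  -- Permuting the list also permutes its sublists, hence the invariance required of `f`. Swapping
  -- the two front entries exchanges the sums over the sublists that contain exactly one of them.
  sublistSum-↭ : ∀ (f : List A → ℕ) → (∀ {s t} → s ↭ t → f s ≡ f t) →
                 ∀ {xs ys} → xs ↭ ys → sublistSum f xs ≡ sublistSum f ys
  sublistSum-↭ f f-↭ Perm.refl = refl
  sublistSum-↭ f f-↭ (Perm.prep {xs} {ys} x p)
    rewrite sublistSum-∷ f x xs | sublistSum-∷ f x ys
    = cong₂ _+_ (sublistSum-↭ f f-↭ p) (sublistSum-↭ (f ∘ (x ∷_)) (f-↭ ∘ Perm.prep x) p)
  sublistSum-↭ f f-↭ (Perm.swap {xs} {ys} x y p) = begin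
    sublistSum f (x ∷ y ∷ xs)
      ≡⟨ expand x y xs ⟩
    sublistSum f xs + Σy xs + (Σx xs + sublistSum (λ s → f (x ∷ y ∷ s)) xs)
      ≡⟨ cong₂ _+_ (cong₂ _+_ (sublistSum-↭ f f-↭ p) (sublistSum-↭ _ (f-↭ ∘ Perm.prep y) p))
           (cong₂ _+_ (sublistSum-↭ _ (f-↭ ∘ Perm.prep x) p)
             -- Sublists with both entries carry them in opposite orders, which `f` ignores.
             (trans (sublistSum-cong xs λ _ → f-↭ (Perm.swap x y Perm.refl))
                    (sublistSum-↭ _ (f-↭ ∘ Perm.prep y ∘ Perm.prep x) p))) ⟩
    sublistSum f ys + Σy ys + (Σx ys + sublistSum (λ s → f (y ∷ x ∷ s)) ys)
      ≡⟨ lemma (sublistSum f ys) (Σy ys) (Σx ys) _ ⟩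
    sublistSum f ys + Σx ys + (Σy ys + sublistSum (λ s → f (y ∷ x ∷ s)) ys)
      ≡⟨ expand y x ys ⟨
    sublistSum f (y ∷ x ∷ ys) ∎
    where
    open ≡-Reasoning
    Σx Σy : List _ → ℕ
    Σx = sublistSum (f ∘ (x ∷_))
    Σy = sublistSum (f ∘ (y ∷_))
    expand : ∀ a b zs → sublistSum f (a ∷ b ∷ zs) ≡
      sublistSum f zs + sublistSum (f ∘ (b ∷_)) zs
        + (sublistSum (f ∘ (a ∷_)) zs + sublistSum (λ s → f (a ∷ b ∷ s)) zs)
    expand a b zs
      rewrite sublistSum-∷ f a (b ∷ zs) | sublistSum-∷ f b zs | sublistSum-∷ (f ∘ (a ∷_)) b zs
      = refl
    lemma : ∀ a b c d → a + b + (c + d) ≡ a + c + (b + d)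
    lemma = solve-∀
  sublistSum-↭ f f-↭ (Perm.trans p q) = trans (sublistSum-↭ f f-↭ p) (sublistSum-↭ f f-↭ q)

  -- Sublists and permutations of lists without repetition

  AllPairs-++⁻ : ∀ {R : A → A → Set} xs {ys} → AllPairs R (xs ++ ys) →
                 AllPairs R ys × All (λ x → All (R x) ys) xs
  AllPairs-++⁻ []       rs       = rs , []
  AllPairs-++⁻ (x ∷ xs) (r ∷ rs) with AllPairs-++⁻ xs rs
  ... | rys , rxys = rys , All.++⁻ʳ xs r ∷ rxys

  -- A sublist keeps the order of the ambient list, so in a list without repetitions it is
  -- determined by its set of members.
  ⊑⇒≡filter : {P : A → Set} (P? : Decidable P) → ∀ {xs s} → Unique xs → s ⊑ xs →
              (∀ {x} → x ∈ xs → x ∈ s ⇔ P x) → s ≡ filter P? xs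
  ⊑⇒≡filter P? _ Sublist.[] _ = refl
  ⊑⇒≡filter P? {x ∷ xs} uxs@(_ ∷ u) (.x Sublist.∷ʳ s⊑xs) eqv with P? x
  ... | yes px = contradiction (Sublist.lookup s⊑xs (Equivalence.from (eqv (here refl)) px))
                               (Unique[x∷xs]⇒x∉xs uxs)
  ... | no _   = ⊑⇒≡filter P? u s⊑xs (eqv ∘ there)
  ⊑⇒≡filter {P = P} P? {x ∷ xs} {.x ∷ s} uxs@(_ ∷ u) (refl Sublist.∷ s⊑xs) eqv with P? x
  ... | yes _  = cong (x ∷_) (⊑⇒≡filter P? u s⊑xs λ {y} y∈xs →
                   mk⇔ (Equivalence.to (eqv (there y∈xs)) ∘ there) (from y∈xs))
    where
    from : ∀ {y} → y ∈ xs → P y → y ∈ s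
    from y∈xs py with Equivalence.from (eqv (there y∈xs)) py
    ... | here refl = contradiction y∈xs (Unique[x∷xs]⇒x∉xs uxs)
    ... | there y∈s = y∈s
  ... | no ¬px = contradiction (Equivalence.to (eqv (here refl)) (here refl)) ¬px

  unique∧set⇒↭ : ∀ {xs ys : List A} → Unique xs → Unique ys → (∀ {x} → x ∈ xs ⇔ x ∈ ys) → xs ↭ ys
  unique∧set⇒↭ uxs uys eqv = ∼bag⇒↭ (unique∧set⇒bag uxs uys eqv)

  -- Tilings determined by their large tiles

  -- From here on a cell c also stands for the large tile large c.
  Fits : Region → Cell → Set
  Fits R c = cells (large c) ⊆ R

  fits? : ∀ R → Decidable (Fits R)
  fits? R c = cells (large c) ⊆? R

  Apart : Cell → Cell → Set
  Apart c d = Disjoint (cells (large c)) (cells (large d))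

  apart? : ∀ c → Decidable (Apart c)
  apart? c d = disjoint? (cells (large c)) (cells (large d))

  Packing : List Cell → Set
  Packing = AllPairs Apart

  packing? : Decidable Packing
  packing? = allPairs? apart?

  anchors : Region → List Cell
  anchors R = filter (fits? R) R

  covered : List Cell → Region
  covered = concatMap (cells ∘ large)

  uncovered? : ∀ cs → Decidable (_∉ covered cs)
  uncovered? cs c = ¬? (c ∈? covered cs)

  -- Completes large tiles by a small tile on every cell left over. Small tiles come first, as in
  -- `candidates`, so that the result has the shape of its sublists.
  fill : Region → List Cell → List Tile
  fill R cs = map small (filter (uncovered? cs) R) ++ map large cs

  packingSum : (List Cell → ℕ) → List Cell → ℕ
  packingSum g = sublistSum (λ cs → weight (packing? cs) (g cs))

  concatMap-cells : ∀ ss cs → concatMap cells (map small ss ++ map large cs) ≡ ss ++ covered cs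
  concatMap-cells ss cs = begin
    concatMap cells (map small ss ++ map large cs)
      ≡⟨ concatMap-++ cells (map small ss) (map large cs) ⟩
    concatMap cells (map small ss) ++ concatMap cells (map large cs)
      ≡⟨ cong₂ _++_ (trans (concatMap-map cells small ss) (concatMap-pure ss))
                    (concatMap-map cells large cs) ⟩
    ss ++ covered cs ∎
    where open ≡-Reasoning

  -- Disjointness keeps small tiles off the cells under large tiles, and covering forces one on
  -- every other cell.
  smalls-forced : ∀ {R ss cs} → Unique R → ss ⊑ R → IsTiling R (map small ss ++ map large cs) →
                  ss ≡ filter (uncovered? cs) R
  smalls-forced {R} {ss} {cs} u ss⊑R (_ , pairs , covers) =
    ⊑⇒≡filter (uncovered? cs) u ss⊑R λ c∈R → mk⇔ to (from c∈R)
    where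
    to : ∀ {c} → c ∈ ss → c ∉ covered cs
    to c∈ss c∈cov with find (∈-concatMap⁻ (cells ∘ large) {xs = cs} c∈cov)
    ... | d , d∈cs , c∈d =
      All.lookup (All.lookup (proj₂ (AllPairs-++⁻ (map small ss) pairs)) (∈-map⁺ small c∈ss))
                 (∈-map⁺ large d∈cs) (here refl , c∈d)
    from : ∀ {c} → c ∈ R → c ∉ covered cs → c ∈ ss
    from c∈R c∉cov with ∈-++⁻ ss (subst (_ ∈_) (concatMap-cells ss cs) (covers c∈R))
    ... | inj₁ c∈ss  = c∈ss
    ... | inj₂ c∈cov = contradiction c∈cov c∉cov

  larges-fit : ∀ {R} ss {cs} → IsTiling R (map small ss ++ map large cs) → All (Fits R) cs
  larges-fit ss (contained , _) = All.map⁻ (All.++⁻ʳ (map small ss) contained)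

  larges-packing : ∀ {R} ss {cs} → IsTiling R (map small ss ++ map large cs) → Packing cs
  larges-packing ss (_ , pairs , _) =
    AllPairs.map⁻ (proj₁ (AllPairs-++⁻ (map small ss) pairs))

  -- Converse to `larges-fit` and `larges-packing`: once the leftover cells are filled, these two
  -- conditions also suffice.
  fill-isTiling : ∀ {R cs} → Unique R → All (Fits R) cs → Packing cs → IsTiling R (fill R cs)
  fill-isTiling {R} {cs} u fit pack = contained , pairs , covers
    where
    free : List Cell
    free = filter (uncovered? cs) R
    free⁻ : ∀ {c} → c ∈ free → c ∈ R × c ∉ covered cs
    free⁻ = ∈-filter⁻ (uncovered? cs) {xs = R}
    contained : All (λ t → cells t ⊆ R) (fill R cs)
    contained = All.++⁺
      (All.map⁺ (All.tabulate λ c∈free → λ { (here refl) → proj₁ (free⁻ c∈free) }))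
      (All.map⁺ fit)
    pairs : AllPairs (λ t t′ → Disjoint (cells t) (cells t′)) (fill R cs)
    pairs = AllPairs.++⁺
      (AllPairs.map⁺ (AllPairs.map (λ c≢d → λ { (here refl , here refl) → c≢d refl })
                                   (Unique.filter⁺ (uncovered? cs) u)))
      (AllPairs.map⁺ pack)
      (All.map⁺ (All.tabulate λ c∈free → All.map⁺ (All.tabulate λ d∈cs → λ { (here refl , c∈d) →
        proj₂ (free⁻ c∈free) (∈-concatMap⁺ (cells ∘ large) (lose d∈cs c∈d)) })))
    covers : R ⊆ concatMap cells (fill R cs)
    covers {c} c∈R rewrite concatMap-cells free cs with c ∈? covered cs
    ... | yes c∈cov = ∈-++⁺ʳ free c∈cov
    ... | no  c∉cov = ∈-++⁺ˡ (∈-filter⁺ (uncovered? cs) c∈R c∉cov)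

  -- Number of tiles in a completed packing

  cells-unique : ∀ t → Unique (cells t)
  cells-unique (small c) = [] ∷ []
  cells-unique (large (up a b)) =
    (ℤ.i≢suc[i] ∘ up-injectiveˡ ∷ ℤ.i≢suc[i] ∘ up-injectiveʳ ∷ (λ ()) ∷ [])
    ∷ (ℤ.i≢suc[i] ∘ sym ∘ up-injectiveˡ ∷ (λ ()) ∷ [])
    ∷ ((λ ()) ∷ []) ∷ [] ∷ []
    where
    up-injectiveˡ : ∀ {a b c d} → up a b ≡ up c d → a ≡ c
    up-injectiveˡ refl = refl
    up-injectiveʳ : ∀ {a b c d} → up a b ≡ up c d → b ≡ d
    up-injectiveʳ refl = refl
  cells-unique (large (down a b)) =
    (ℤ.i≢suc[i] ∘ down-injectiveʳ ∷ ℤ.i≢suc[i] ∘ down-injectiveʳ ∷ (λ ()) ∷ [])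
    -- If `a` were equal to `pred a`, then `pred a` would be its own successor.
    ∷ ((λ eq → ℤ.i≢suc[i] (trans (sym (down-injectiveˡ eq)) (sym (ℤ.suc-pred a)))) ∷ (λ ()) ∷ [])
    ∷ ((λ ()) ∷ []) ∷ [] ∷ []
    where
    down-injectiveˡ : ∀ {a b c d} → down a b ≡ down c d → a ≡ c
    down-injectiveˡ refl = refl
    down-injectiveʳ : ∀ {a b c d} → down a b ≡ down c d → b ≡ d
    down-injectiveʳ refl = refl

  length-covered : ∀ cs → length (covered cs) ≡ 4 * length cs
  length-covered []       = refl
  length-covered (c ∷ cs) = begin
    length (cells (large c) ++ covered cs)         ≡⟨ length-++ (cells (large c)) ⟩
    length (cells (large c)) + length (covered cs) ≡⟨ cong₂ _+_ (four c) (length-covered cs) ⟩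
    4 + 4 * length cs                              ≡⟨ *-distribˡ-+ 4 1 (length cs) ⟨
    4 * suc (length cs)                            ∎
    where
    open ≡-Reasoning
    four : ∀ c → length (cells (large c)) ≡ 4
    four (up _ _)   = refl
    four (down _ _) = refl

  covered⊆ : ∀ {R cs} → All (Fits R) cs → covered cs ⊆ R
  covered⊆ {cs = cs} fit c∈cov with find (∈-concatMap⁻ (cells ∘ large) {xs = cs} c∈cov)
  ... | _ , d∈cs , c∈d = All.lookup fit d∈cs c∈d

  covered-unique : ∀ {cs} → Packing cs → Unique (covered cs)
  covered-unique {cs} pack =
    Unique.concat⁺ (All.map⁺ {xs = cs} (All.tabulate λ {c} _ → cells-unique (large c)))
                   (AllPairs.map⁺ pack)

  -- Each large tile replaces four cells by one tile. The loss of three is added on the left, which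
  -- avoids truncated subtraction.
  length-fill : ∀ {R cs} → Unique R → All (Fits R) cs → Packing cs →
                length (fill R cs) + 3 * length cs ≡ length R
  length-fill {R} {cs} u fit pack = begin
    length (fill R cs) + 3 * length cs
      ≡⟨ cong (_+ 3 * length cs)
           (trans (length-++ (map small free))
                  (cong₂ _+_ (length-map small free) (length-map large cs))) ⟩
    length free + length cs + 3 * length cs
      ≡⟨ lemma (length free) (length cs) ⟩
    4 * length cs + length free
      ≡⟨ cong (_+ length free) (length-covered cs) ⟨
    length (covered cs) + length free
      ≡⟨ cong (_+ length free) (↭-length covered↭) ⟩
    length (filter (_∈? covered cs) R) + length free
      ≡⟨ length-filter-filter (_∈? covered cs) (uncovered? cs) (mk⇔ id id) R ⟩
    length R ∎
    where
    open ≡-Reasoning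
    free : List Cell
    free = filter (uncovered? cs) R
    covered↭ : covered cs ↭ filter (_∈? covered cs) R
    -- Both lists consist, without repetition, of the cells under the large tiles, all of which lie
    -- in `R`.
    covered↭ = unique∧set⇒↭ (covered-unique pack) (Unique.filter⁺ (_∈? covered cs) u)
      (mk⇔ (λ c∈ → ∈-filter⁺ (_∈? covered cs) (covered⊆ fit c∈) c∈)
           (proj₂ ∘ ∈-filter⁻ (_∈? covered cs) {xs = R}))
    lemma : ∀ a b → a + b + 3 * b ≡ 4 * b + a
    lemma = solve-∀

  -- From sums over tilings to sums over packings

  anchors-fit : ∀ {R cs} → cs ⊑ anchors R → All (Fits R) cs
  anchors-fit {R} cs⊑ = All-resp-⊆ cs⊑ (All.all-filter (fits? R) R)

  -- A sublist of the candidates is a choice of small tiles and one of large tiles. For given large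
  -- tiles only the completion `fill` can be a tiling, and it is one exactly when they fit in `R`
  -- and form a packing. Arbitrary `g` covers both the number of tilings and the number of tiles.
  sum-tilings : ∀ (g : List Tile → ℕ) {R} → Unique R →
                sum (map g (tilings R)) ≡ packingSum (g ∘ fill R) (anchors R)
  sum-tilings g {R} u = begin
    sum (map g (tilings R))
      ≡⟨ sum-map-filter (isTiling? R) g (sublists (candidates R)) ⟩
    sublistSum f (candidates R)
      ≡⟨ sublistSum-++ f (map small R) (map large R) ⟩
    sublistSum (λ ls → sublistSum (λ ss → f (ss ++ ls)) (map small R)) (map large R)
      ≡⟨ sublistSum-map large _ R ⟩
    sublistSum (λ cs → sublistSum (λ ss → f (ss ++ map large cs)) (map small R)) R
      ≡⟨ sublistSum-cong R (λ {cs} _ → trans (sublistSum-map small _ R) (inner cs)) ⟩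
    sublistSum (f ∘ fill R) R
      ≡⟨ sublistSum-filter (fits? R) (f ∘ fill R)
           (λ {cs} ¬fit → weight-no (isTiling? R (fill R cs))
              (¬fit ∘ larges-fit (filter (uncovered? cs) R)) (g (fill R cs))) R ⟩
    sublistSum (f ∘ fill R) (anchors R)
      ≡⟨ sublistSum-cong (anchors R) (λ {cs} cs⊑ →
           weight-⇔ (isTiling? R (fill R cs)) (packing? cs)
             (mk⇔ (larges-packing (filter (uncovered? cs) R)) (fill-isTiling u (anchors-fit cs⊑)))
             (g (fill R cs))) ⟩
    packingSum (g ∘ fill R) (anchors R) ∎
    where
    open ≡-Reasoning
    f : List Tile → ℕ
    f ts = weight (isTiling? R ts) (g ts)
    inner : ∀ cs → sublistSum (λ ss → f (map small ss ++ map large cs)) R ≡ f (fill R cs)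
    inner cs = sublistSum-single (uncovered? cs) (λ ss → f (map small ss ++ map large cs)) u
      λ ss⊑R ss≢ → weight-no (isTiling? R _) (ss≢ ∘ smalls-forced u ss⊑R) _

  -- Numbers of packings and of large tiles in them

  count : List Cell → ℕ
  count = packingSum (const 1)

  total : List Cell → ℕ
  total = packingSum length

  packingSum-cong : ∀ {g g′ : List Cell → ℕ} cs → (∀ {s} → s ⊑ cs → Packing s → g s ≡ g′ s) →
                    packingSum g cs ≡ packingSum g′ cs
  packingSum-cong {g} {g′} cs g≗g′ = sublistSum-cong cs eq
    where
    eq : ∀ {s} → s ⊑ cs → weight (packing? s) (g s) ≡ weight (packing? s) (g′ s)
    eq {s} s⊑ with packing? s
    ... | yes pack = g≗g′ s⊑ pack
    ... | no _     = refl

  packingSum-+ : ∀ (g g′ : List Cell → ℕ) cs →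
                 packingSum (λ s → g s + g′ s) cs ≡ packingSum g cs + packingSum g′ cs
  packingSum-+ g g′ cs = trans (sublistSum-cong cs (λ {s} _ → weight-+ s)) (sublistSum-+ _ _ cs)
    where
    weight-+ : ∀ s → weight (packing? s) (g s + g′ s)
                   ≡ weight (packing? s) (g s) + weight (packing? s) (g′ s)
    weight-+ s with packing? s
    ... | yes _ = refl
    ... | no _  = refl

  packingSum-* : ∀ k (g : List Cell → ℕ) cs → packingSum (λ s → k * g s) cs ≡ k * packingSum g cs
  packingSum-* k g cs = trans (sublistSum-cong cs (λ {s} _ → weight-* s)) (sublistSum-* k _ cs)
    where
    weight-* : ∀ s → weight (packing? s) (k * g s) ≡ k * weight (packing? s) (g s)
    weight-* s with packing? s
    ... | yes _ = refl
    ... | no _  = sym (*-zeroʳ k)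
  
  numTilings≡count : ∀ {R} → Unique R → numTilings R ≡ count (anchors R)
  numTilings≡count {R} u = trans (length≡sum (tilings R)) (sum-tilings (const 1) u)

  -- Summing `length-fill` over all packings leaves only `count` and `total` to be found.
  totalTiles+3total : ∀ {R} → Unique R →
    totalTiles R + 3 * total (anchors R) ≡ length R * count (anchors R)
  totalTiles+3total {R} u = begin
    totalTiles R + 3 * total (anchors R)
      ≡⟨ cong₂ _+_ (sum-tilings length u) (sym (packingSum-* 3 length (anchors R))) ⟩
    packingSum (length ∘ fill R) (anchors R) + packingSum (λ s → 3 * length s) (anchors R)
      ≡⟨ packingSum-+ (length ∘ fill R) _ (anchors R) ⟨
    packingSum (λ s → length (fill R s) + 3 * length s) (anchors R)
      ≡⟨ packingSum-cong (anchors R) (λ s⊑ pack →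
           trans (length-fill u (anchors-fit s⊑) pack) (sym (*-identityʳ (length R)))) ⟩
    -- The factor `1` presents the constant summand as a multiple of the one that defines `count`.
    packingSum (λ s → length R * 1) (anchors R)
      ≡⟨ packingSum-* (length R) (const 1) (anchors R) ⟩
    length R * count (anchors R) ∎
    where
    open ≡-Reasoning

  -- Overlap is symmetric, so being a packing does not depend on the order. The row-by-row list of
  -- anchors can thus be replaced by one ordered along the strip.
  packingSum-↭ : ∀ (g : List Cell → ℕ) → (∀ {s t} → s ↭ t → g s ≡ g t) →
                 ∀ {cs ds} → cs ↭ ds → packingSum g cs ≡ packingSum g ds
  packingSum-↭ g g-↭ = sublistSum-↭ _ λ {s} {t} s↭t →
    trans (cong (weight (packing? s)) (g-↭ s↭t))
          (weight-⇔ (packing? s) (packing? t)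
            (mk⇔ (packing-↭ s↭t) (packing-↭ (Perm.↭-sym s↭t))) (g t))
    where
    packing-↭ : ∀ {s t} → s ↭ t → Packing s → Packing t
    packing-↭ s↭t = PermSetoid.AllPairs-resp-↭ (setoid Cell)
      (λ c#d → λ { (x , y) → c#d (y , x) }) (resp₂ Apart) (↭⇒↭ₛ s↭t)

  -- A packing either omits `c` or contains it; in the second case its other tiles form a packing
  -- chosen among those apart from `c`.
  packingSum-∷ : ∀ (g : List Cell → ℕ) c cs →
    packingSum g (c ∷ cs) ≡ packingSum g cs + packingSum (g ∘ (c ∷_)) (filter (apart? c) cs)
  packingSum-∷ g c cs = begin
    packingSum g (c ∷ cs)
      ≡⟨ sublistSum-∷ f c cs ⟩
    packingSum g cs + sublistSum (f ∘ (c ∷_)) cs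
      ≡⟨ cong (packingSum g cs +_) (sublistSum-filter (apart? c) (f ∘ (c ∷_))
           (λ {s} ¬apart → weight-no (packing? (c ∷ s)) (λ { (apart ∷ _) → ¬apart apart })
              (g (c ∷ s))) cs) ⟩
    packingSum g cs + sublistSum (f ∘ (c ∷_)) (filter (apart? c) cs)
      ≡⟨ cong (packingSum g cs +_) (sublistSum-cong (filter (apart? c) cs) λ {s} s⊑ →
           weight-⇔ (packing? (c ∷ s)) (packing? s)
             (mk⇔ AllPairs.tail (All-resp-⊆ s⊑ (All.all-filter (apart? c) cs) ∷_)) (g (c ∷ s))) ⟩
    packingSum g cs + packingSum (g ∘ (c ∷_)) (filter (apart? c) cs) ∎
    where
    open ≡-Reasoning
    f : List Cell → ℕ
    f s = weight (packing? s) (g s)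

  count-∷ : ∀ c cs → count (c ∷ cs) ≡ count cs + count (filter (apart? c) cs)
  count-∷ = packingSum-∷ (const 1)

  -- Each packing containing `c` has `c` as one additional tile, whence the extra `count` term.
  total-∷ : ∀ c cs → total (c ∷ cs) ≡
            total cs + (count (filter (apart? c) cs) + total (filter (apart? c) cs))
  total-∷ c cs = trans (packingSum-∷ length c cs)
    (cong (total cs +_) (packingSum-+ (const 1) length (filter (apart? c) cs)))

  -- Overlaps of the large tiles along the strip

  open import Data.Integer.Base using (+_)

  -- upAnchor k and downAnchor k stand for the large tiles U_k and D_k.
  upAnchor downAnchor : ℕ → Cell
  upAnchor k   = up (+ k) 0ℤ
  downAnchor k = down (+ suc k) 0ℤ

  -- Separate bounds for the two orientations, since `regionP` loses the last up tile but no down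
  -- tile.
  data Anchor (i j : ℕ) : Cell → Set where
    isUp   : ∀ {k} → k < i → Anchor i j (upAnchor k)
    isDown : ∀ {k} → k < j → Anchor i j (downAnchor k)

  -- Listed from right to left, so that the last tiles are peeled off first. `chainH m` and
  -- `chainP m` belong to the regions of index `suc m`; `chainP′ m` lacks the last down tile instead
  -- of the last up tile and is what remains once `downAnchor m` is taken.
  chainH chainP chainP′ : ℕ → List Cell
  chainH zero     = []
  chainH (suc m)  = downAnchor m ∷ upAnchor m ∷ chainH m
  chainP zero     = []
  chainP (suc m)  = downAnchor m ∷ chainH m
  chainP′ zero    = []
  chainP′ (suc m) = upAnchor m ∷ chainH m

  Anchor-weaken : ∀ {i j i′ j′ c} → i ≤ i′ → j ≤ j′ → Anchor i j c → Anchor i′ j′ c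
  Anchor-weaken i≤ _ (isUp k<i)   = isUp (<-≤-trans k<i i≤)
  Anchor-weaken _ j≤ (isDown k<j) = isDown (<-≤-trans k<j j≤)

  ∈-chainH⁻ : ∀ m {c} → c ∈ chainH m → Anchor m m c
  ∈-chainH⁻ (suc m) (here refl)         = isDown (n<1+n m)
  ∈-chainH⁻ (suc m) (there (here refl)) = isUp (n<1+n m)
  ∈-chainH⁻ (suc m) (there (there c∈))  = Anchor-weaken (n≤1+n m) (n≤1+n m) (∈-chainH⁻ m c∈)

  ∈-chainH⁺ : ∀ m {c} → Anchor m m c → c ∈ chainH m
  ∈-chainH⁺ (suc m) (isUp k<1+m) with m<1+n⇒m<n∨m≡n k<1+m
  ... | inj₁ k<m  = there (there (∈-chainH⁺ m (isUp k<m)))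
  ... | inj₂ refl = there (here refl)
  ∈-chainH⁺ (suc m) (isDown k<1+m) with m<1+n⇒m<n∨m≡n k<1+m
  ... | inj₁ k<m  = there (there (∈-chainH⁺ m (isDown k<m)))
  ... | inj₂ refl = here refl

  ∈-chainP⁻ : ∀ m {c} → c ∈ chainP m → Anchor (m ∸ 1) m c
  ∈-chainP⁻ (suc m) (here refl) = isDown (n<1+n m)
  ∈-chainP⁻ (suc m) (there c∈)  = Anchor-weaken ≤-refl (n≤1+n m) (∈-chainH⁻ m c∈)

  ∈-chainP⁺ : ∀ m {c} → Anchor (m ∸ 1) m c → c ∈ chainP m
  ∈-chainP⁺ (suc m) (isUp k<m) = there (∈-chainH⁺ m (isUp k<m))
  ∈-chainP⁺ (suc m) (isDown k<1+m) with m<1+n⇒m<n∨m≡n k<1+m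
  ... | inj₁ k<m  = there (∈-chainH⁺ m (isDown k<m))
  ... | inj₂ refl = here refl

  chainH-unique : ∀ m → Unique (chainH m)
  chainH-unique zero    = []
  chainH-unique (suc m) =
    ((λ ()) ∷ All.tabulate λ c∈ → λ { refl → fresh-down (∈-chainH⁻ m c∈) })
    ∷ All.tabulate (λ c∈ → λ { refl → fresh-up (∈-chainH⁻ m c∈) })
    ∷ chainH-unique m
    where
    fresh-up : ¬ Anchor m m (upAnchor m)
    fresh-up (isUp m<m) = <-irrefl refl m<m
    fresh-down : ¬ Anchor m m (downAnchor m)
    fresh-down (isDown m<m) = <-irrefl refl m<m

  chainP-unique : ∀ m → Unique (chainP m)
  chainP-unique zero    = []
  chainP-unique (suc m) with chainH-unique (suc m)
  ... | (_ ∷ d∉) ∷ _ ∷ u = d∉ ∷ u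

  -- Measures horizontal position in ℕ. The tiles in question have no cell with a negative first
  -- coordinate, so the absolute value loses nothing.
  abscissa : Cell → ℕ
  abscissa (up a b)   = ℤ.∣ a ∣
  abscissa (down a b) = ℤ.∣ a ∣

  Near : ℕ → Cell → Set
  Near k c = k ≤ abscissa c × abscissa c ≤ suc k

  upAnchor-near : ∀ k → All (Near k) (cells (large (upAnchor k)))
  upAnchor-near k =
    (≤-refl , n≤1+n k) ∷ (n≤1+n k , ≤-refl) ∷ (≤-refl , n≤1+n k) ∷ (n≤1+n k , ≤-refl) ∷ []

  downAnchor-near : ∀ k → All (Near k) (cells (large (downAnchor k)))
  downAnchor-near k =
    (n≤1+n k , ≤-refl) ∷ (n≤1+n k , ≤-refl) ∷ (≤-refl , n≤1+n k) ∷ (≤-refl , n≤1+n k) ∷ []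

  -- The coordinate ranges `k`, `k + 1` and `l`, `l + 1` do not meet. Only tiles with equal or
  -- adjacent index are left for a check cell by cell.
  near⇒apart : ∀ {k l c d} → suc k < l → All (Near l) (cells (large c)) →
               All (Near k) (cells (large d)) → Apart c d
  near⇒apart 1+k<l near-c near-d (v∈c , v∈d) =
    <⇒≱ 1+k<l (≤-trans (proj₁ (All.lookup near-c v∈c)) (proj₂ (All.lookup near-d v∈d)))

  near⇒apart-chainH : ∀ {m c} → All (Near (suc m)) (cells (large c)) → All (Apart c) (chainH m)
  near⇒apart-chainH {m} {c} near-c = All.tabulate (apart ∘ ∈-chainH⁻ m)
    where
    apart : ∀ {d} → Anchor m m d → Apart c d
    apart (isUp {k} k<m)   = near⇒apart {c = c} {upAnchor k} (s<s k<m) near-c (upAnchor-near k)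
    apart (isDown {k} k<m) = near⇒apart {c = c} {downAnchor k} (s<s k<m) near-c (downAnchor-near k)

  -- Two coincidences are possible, between the down cells in row 0 and between the up cells in row
  -- 1, and each forces `k ≡ l`. All other pairs of cells differ in orientation or row.
  down-apart-up : ∀ {k l} → k ≢ l → Apart (downAnchor k) (upAnchor l)
  down-apart-up k≢l (here refl , there (there (there (here refl)))) = k≢l refl
  down-apart-up k≢l (there (there (there (here refl))) , there (there (here refl))) = k≢l refl
  down-apart-up k≢l (here refl , there (there (there (there ()))))
  down-apart-up k≢l (there (here refl) , there (there (there (here ()))))
  down-apart-up k≢l (there (here refl) , there (there (there (there ()))))
  down-apart-up k≢l (there (there (here refl)) , there (there (there (here ()))))
  down-apart-up k≢l (there (there (here refl)) , there (there (there (there ()))))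
  down-apart-up k≢l (there (there (there (here refl))) , there (there (there (here ()))))

  -- Taking `downAnchor m` excludes `upAnchor m` and the previous down tile; the previous up tile
  -- and everything further left survive.
  filter-apart-down : ∀ m → filter (apart? (downAnchor m)) (upAnchor m ∷ chainH m) ≡ chainP′ m
  filter-apart-down zero = filter-reject (apart? (downAnchor 0)) {upAnchor 0} {[]}
    λ apart → apart (here refl , there (there (there (here refl))))
  filter-apart-down (suc m) = begin
    filter dn? (upAnchor (suc m) ∷ downAnchor m ∷ upAnchor m ∷ chainH m)
      ≡⟨ filter-reject dn? {upAnchor (suc m)}
           (λ apart → apart (here refl , there (there (there (here refl))))) ⟩
    filter dn? (downAnchor m ∷ upAnchor m ∷ chainH m)
      -- The consecutive down tiles share the cell `down (+ suc m) 1ℤ`.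
      ≡⟨ filter-reject dn? {downAnchor m}
           (λ apart → apart (there (there (here refl)) , there (here refl))) ⟩
    filter dn? (upAnchor m ∷ chainH m)
      ≡⟨ filter-accept dn? {upAnchor m} (down-apart-up 1+n≢n) ⟩
    upAnchor m ∷ filter dn? (chainH m)
      ≡⟨ cong (upAnchor m ∷_)
           (filter-all dn? (near⇒apart-chainH {c = downAnchor (suc m)} (downAnchor-near (suc m)))) ⟩
    upAnchor m ∷ chainH m ∎
    where
    open ≡-Reasoning
    dn? = apart? (downAnchor (suc m))

  -- Putting `upAnchor m` in front changes nothing, because it overlaps `downAnchor m` and is
  -- filtered out.
  filter-apart-down-chainH : ∀ m → filter (apart? (downAnchor m)) (chainH m) ≡ chainP′ m
  filter-apart-down-chainH m = trans
    (sym (filter-reject (apart? (downAnchor m)) {upAnchor m}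
      (λ apart → apart (here refl , there (there (there (here refl)))))))
    (filter-apart-down m)

  filter-apart-up : ∀ m → filter (apart? (upAnchor m)) (chainH m) ≡ chainP m
  filter-apart-up zero    = refl
  filter-apart-up (suc m) = begin
    filter up? (downAnchor m ∷ upAnchor m ∷ chainH m)
      ≡⟨ filter-accept up? {downAnchor m}
           (λ (v∈up , v∈down) → down-apart-up (1+n≢n ∘ sym) (v∈down , v∈up)) ⟩
    downAnchor m ∷ filter up? (upAnchor m ∷ chainH m)
      ≡⟨ cong (downAnchor m ∷_) (filter-reject up? {upAnchor m}
           (λ apart → apart (here refl , there (here refl)))) ⟩
    downAnchor m ∷ filter up? (chainH m)
      ≡⟨ cong (downAnchor m ∷_)
           (filter-all up? (near⇒apart-chainH {c = upAnchor (suc m)} (upAnchor-near (suc m)))) ⟩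
    downAnchor m ∷ chainH m ∎
    where
    open ≡-Reasoning
    up? = apart? (upAnchor (suc m))

  -- Recurrences for packings of the chains

  -- Reflecting the strip in its horizontal axis exchanges chainP and chainP′.
  count-chainP′ : ∀ m → count (chainP′ m) ≡ count (chainP m)
  count-chainP′ zero    = refl
  count-chainP′ (suc m)
    rewrite count-∷ (upAnchor m) (chainH m) | count-∷ (downAnchor m) (chainH m)
          | filter-apart-up m | filter-apart-down-chainH m
    = cong (λ k → count (chainH m) + k) (sym (count-chainP′ m))

  total-chainP′ : ∀ m → total (chainP′ m) ≡ total (chainP m)
  total-chainP′ zero    = refl
  total-chainP′ (suc m)
    rewrite total-∷ (upAnchor m) (chainH m) | total-∷ (downAnchor m) (chainH m)
          | filter-apart-up m | filter-apart-down-chainH m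
          | count-chainP′ m | total-chainP′ m
    = refl

  count-chainP-suc : ∀ m → count (chainP (suc m)) ≡ count (chainH m) + count (chainP m)
  count-chainP-suc m
    rewrite count-∷ (downAnchor m) (chainH m) | filter-apart-down-chainH m | count-chainP′ m
    = refl

  -- Omitting `downAnchor m` leaves `upAnchor m ∷ chainH m`, which is `chainP′ (suc m)` and has as
  -- many packings as `chainP (suc m)`.
  count-chainH-suc : ∀ m → count (chainH (suc m)) ≡ count (chainP (suc m)) + count (chainP m)
  count-chainH-suc m
    rewrite count-∷ (downAnchor m) (upAnchor m ∷ chainH m) | filter-apart-down m | count-chainP′ m
    = cong (λ k → k + count (chainP m)) (count-chainP′ (suc m))

  total-chainP-suc : ∀ m → total (chainP (suc m)) ≡
                     total (chainH m) + (count (chainP m) + total (chainP m))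
  total-chainP-suc m
    rewrite total-∷ (downAnchor m) (chainH m) | filter-apart-down-chainH m
          | count-chainP′ m | total-chainP′ m
    = refl

  total-chainH-suc : ∀ m → total (chainH (suc m)) ≡
                     total (chainP (suc m)) + (count (chainP m) + total (chainP m))
  total-chainH-suc m
    rewrite total-∷ (downAnchor m) (upAnchor m ∷ chainH m) | filter-apart-down m
          | count-chainP′ m | total-chainP′ m
    = cong (λ k → k + (count (chainP m) + total (chainP m))) (total-chainP′ (suc m))

  -- For `m = 0` the empty packing is the only one. The step for `chainP` uses both hypotheses; the
  -- step for `chainH` uses the new identity for `chainP` together with the old one.
  total-chain : ∀ m → 2 * total (chainP m) ≡ m * count (chainP m) ×
                      2 * total (chainH m) + count (chainP m) ≡ suc m * count (chainH m)
  total-chain zero    = refl , refl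
  total-chain (suc m) = goalP , goalH
    where
    open ≡-Reasoning
    cH cP tH tP : ℕ
    cH = count (chainH m)
    cP = count (chainP m)
    tH = total (chainH m)
    tP = total (chainP m)
    ihP : 2 * tP ≡ m * cP
    ihP = proj₁ (total-chain m)
    ihH : 2 * tH + cP ≡ suc m * cH
    ihH = proj₂ (total-chain m)
    lemma₁ : ∀ a b c → 2 * (a + (b + c)) ≡ 2 * a + b + (b + 2 * c)
    lemma₁ = solve-∀
    lemma₂ : ∀ m a b → (1 + m) * a + (b + m * b) ≡ (1 + m) * (a + b)
    lemma₂ = solve-∀
    lemma₃ : ∀ a b c d → 2 * (a + (b + c)) + d ≡ 2 * a + 2 * c + (2 * b + d)
    lemma₃ = solve-∀
    lemma₄ : ∀ m a b → (1 + m) * a + m * b + (2 * b + a) ≡ (2 + m) * (a + b)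
    lemma₄ = solve-∀
    goalP : 2 * total (chainP (suc m)) ≡ suc m * count (chainP (suc m))
    goalP = begin
      2 * total (chainP (suc m))          ≡⟨ cong (2 *_) (total-chainP-suc m) ⟩
      2 * (tH + (cP + tP))                ≡⟨ lemma₁ tH cP tP ⟩
      2 * tH + cP + (cP + 2 * tP)         ≡⟨ cong₂ (λ a b → a + (cP + b)) ihH ihP ⟩
      suc m * cH + (cP + m * cP)          ≡⟨ lemma₂ m cH cP ⟩
      suc m * (cH + cP)                   ≡⟨ cong (suc m *_) (count-chainP-suc m) ⟨
      suc m * count (chainP (suc m))      ∎
    goalH : 2 * total (chainH (suc m)) + count (chainP (suc m))
          ≡ suc (suc m) * count (chainH (suc m))
    goalH = begin
      2 * total (chainH (suc m)) + cP⁺    ≡⟨ cong (λ t → 2 * t + cP⁺) (total-chainH-suc m) ⟩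
      2 * (tP⁺ + (cP + tP)) + cP⁺         ≡⟨ lemma₃ tP⁺ cP tP cP⁺ ⟩
      2 * tP⁺ + 2 * tP + (2 * cP + cP⁺)   ≡⟨ cong₂ (λ a b → a + b + (2 * cP + cP⁺)) goalP ihP ⟩
      suc m * cP⁺ + m * cP + (2 * cP + cP⁺)
                                          ≡⟨ lemma₄ m cP⁺ cP ⟩
      suc (suc m) * (cP⁺ + cP)            ≡⟨ cong (suc (suc m) *_) (count-chainH-suc m) ⟨
      suc (suc m) * count (chainH (suc m))
                                          ∎
      where
      cP⁺ tP⁺ : ℕ
      cP⁺ = count (chainP (suc m))
      tP⁺ = total (chainP (suc m))

  -- Cells and large tiles of `regionH`

  data InH (m : ℕ) : Cell → Set where
    up₀   : ∀ {k} → k < suc m → InH m (up (+ k) 0ℤ)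
    down₀ : ∀ {k} → k < m     → InH m (down (+ suc k) 0ℤ)
    down₁ : ∀ {k} → k < suc m → InH m (down (+ k) 1ℤ)
    up₁   : ∀ {k} → k < m     → InH m (up (+ k) 1ℤ)

  module _ (m : ℕ) where

    private
      ups₀ downs₀ downs₁ ups₁ : Region
      ups₀   = map (λ k → up (+ k) 0ℤ) (upTo (suc m))
      downs₀ = map (λ k → down (+ suc k) 0ℤ) (upTo m)
      downs₁ = map (λ k → down (+ k) 1ℤ) (upTo (suc m))
      ups₁   = map (λ k → up (+ k) 1ℤ) (upTo m)

      ∈-row⁺ : ∀ (f : ℕ → Cell) {k n} → k < n → f k ∈ map f (upTo n)
      ∈-row⁺ f k<n = ∈-map⁺ f (∈-upTo⁺ k<n)

      ∈-ups₀ : ∀ {c} → c ∈ ups₀ → InH m c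
      ∈-ups₀ c∈ with ∈-map⁻ _ c∈
      ... | _ , k∈ , refl = up₀ (∈-upTo⁻ k∈)

      ∈-downs₀ : ∀ {c} → c ∈ downs₀ → InH m c
      ∈-downs₀ c∈ with ∈-map⁻ _ c∈
      ... | _ , k∈ , refl = down₀ (∈-upTo⁻ k∈)

      ∈-downs₁ : ∀ {c} → c ∈ downs₁ → InH m c
      ∈-downs₁ c∈ with ∈-map⁻ _ c∈
      ... | _ , k∈ , refl = down₁ (∈-upTo⁻ k∈)

      ∈-ups₁ : ∀ {c} → c ∈ ups₁ → InH m c
      ∈-ups₁ c∈ with ∈-map⁻ _ c∈
      ... | _ , k∈ , refl = up₁ (∈-upTo⁻ k∈)

    ∈-regionH⁺ : ∀ {c} → InH m c → c ∈ regionH (suc m)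
    ∈-regionH⁺ (up₀ k<)   = ∈-++⁺ˡ (∈-++⁺ˡ (∈-row⁺ _ k<))
    ∈-regionH⁺ (down₀ k<) = ∈-++⁺ˡ (∈-++⁺ʳ ups₀ (∈-row⁺ _ k<))
    ∈-regionH⁺ (down₁ k<) = ∈-++⁺ʳ (ups₀ ++ downs₀) (∈-++⁺ˡ (∈-row⁺ _ k<))
    ∈-regionH⁺ (up₁ k<)   = ∈-++⁺ʳ (ups₀ ++ downs₀) (∈-++⁺ʳ downs₁ (∈-row⁺ _ k<))

    ∈-regionH⁻ : ∀ {c} → c ∈ regionH (suc m) → InH m c
    ∈-regionH⁻ = [ [ ∈-ups₀ , ∈-downs₀ ] ∘ ∈-++⁻ ups₀ , [ ∈-downs₁ , ∈-ups₁ ] ∘ ∈-++⁻ downs₁ ]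
               ∘ ∈-++⁻ (ups₀ ++ downs₀)

    regionH-unique : Unique (regionH (suc m))
    regionH-unique = Unique.++⁺
      (Unique.++⁺ (row (suc m) λ { refl → refl }) (row m λ { refl → refl })
        (rows-disjoint (λ ())))
      (Unique.++⁺ (row (suc m) λ { refl → refl }) (row m λ { refl → refl })
        (rows-disjoint (λ ())))
      λ (c∈lower , c∈upper) → lower-upper (∈-++⁻ ups₀ c∈lower) (∈-++⁻ downs₁ c∈upper)
      where
      row : ∀ {f : ℕ → Cell} n → (∀ {k l} → f k ≡ f l → k ≡ l) → Unique (map f (upTo n))
      row n inj = Unique.map⁺ inj (Unique.upTo⁺ n)
      rows-disjoint : ∀ {f g : ℕ → Cell} {ks ls} → (∀ {k l} → f k ≢ g l) →
                      Disjoint (map f ks) (map g ls)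
      rows-disjoint f≢g (c∈f , c∈g) with ∈-map⁻ _ c∈f | ∈-map⁻ _ c∈g
      ... | _ , _ , refl | _ , _ , eq = f≢g eq
      lower-upper : ∀ {c} → c ∈ ups₀ ⊎ c ∈ downs₀ → ¬ (c ∈ downs₁ ⊎ c ∈ ups₁)
      lower-upper (inj₁ x) (inj₁ y) = rows-disjoint (λ ()) (x , y)
      lower-upper (inj₁ x) (inj₂ y) = rows-disjoint (λ ()) (x , y)
      lower-upper (inj₂ x) (inj₁ y) = rows-disjoint (λ ()) (x , y)
      lower-upper (inj₂ x) (inj₂ y) = rows-disjoint (λ ()) (x , y)

    length-regionH : length (regionH (suc m)) ≡ 4 * m + 2
    length-regionH = begin
      length (lowerTrapezoid (suc m) ++ upperTrapezoid (suc m))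
        ≡⟨ length-++ (lowerTrapezoid (suc m)) ⟩
      length (lowerTrapezoid (suc m)) + length (upperTrapezoid (suc m))
        ≡⟨ cong₂ _+_ (two-rows _ _ (suc m) m) (two-rows _ _ (suc m) m) ⟩
      suc m + m + (suc m + m)
        ≡⟨ lemma m ⟩
      4 * m + 2 ∎
      where
      open ≡-Reasoning
      two-rows : ∀ (f g : ℕ → Cell) k l → length (map f (upTo k) ++ map g (upTo l)) ≡ k + l
      two-rows f g k l = trans (length-++ (map f (upTo k)))
        (cong₂ _+_ (trans (length-map f (upTo k)) (length-upTo k))
                   (trans (length-map g (upTo l)) (length-upTo l)))
      lemma : ∀ m → suc m + m + (suc m + m) ≡ 4 * m + 2
      lemma = solve-∀

    private
      ∈-cells : ∀ c → c ∈ cells (large c)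
      ∈-cells (up _ _)   = here refl
      ∈-cells (down _ _) = here refl

    -- Both lists are free of repetitions, so equality as sets is enough. A tile that fits contains
    -- its own anchor cell, hence `from` also supplies membership in `R`.
    anchors-↭ : ∀ {R cs} → Unique R → Unique cs → (∀ {c} → c ∈ R → Fits R c → c ∈ cs) →
                (∀ {c} → c ∈ cs → Fits R c) → anchors R ↭ cs
    anchors-↭ {R} uR ucs to from = unique∧set⇒↭ (Unique.filter⁺ (fits? R) uR) ucs (mk⇔
      (λ c∈ → let c∈R , fits = ∈-filter⁻ (fits? R) {xs = R} c∈ in to c∈R fits)
      (λ c∈ → ∈-filter⁺ (fits? R) (from c∈ (∈-cells _)) (from c∈)))

    fits⇒anchor : ∀ {c} → c ∈ regionH (suc m) → Fits (regionH (suc m)) c → Anchor m m c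
    fits⇒anchor c∈ fits with ∈-regionH⁻ c∈
    ... | down₀ k<m = isDown k<m
    -- The second cell of the large tile is the right neighbour of its anchor, whose presence in the
    -- row bounds the index.
    ... | up₀ _ with ∈-regionH⁻ (fits (there (here refl)))
    ...   | up₀ 1+k<1+m = isUp (s<s⁻¹ 1+k<1+m)
    -- A large tile anchored in the upper row, of either orientation, would reach into row 2, above
    -- the strip.
    fits⇒anchor c∈ fits | down₁ _ with ∈-regionH⁻ (fits (there (here refl)))
    ...   | ()
    fits⇒anchor c∈ fits | up₁ _ with ∈-regionH⁻ (fits (there (there (here refl))))
    ...   | ()

    anchor⇒fits : ∀ {c} → Anchor m m c → Fits (regionH (suc m)) c
    anchor⇒fits (isUp k<m) = All.lookup {P = _∈ regionH (suc m)}
      (∈-regionH⁺ (up₀ (m<n⇒m<1+n k<m)) ∷ ∈-regionH⁺ (up₀ (s<s k<m)) ∷ ∈-regionH⁺ (up₁ k<m)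
        ∷ ∈-regionH⁺ (down₀ k<m) ∷ [])
    anchor⇒fits (isDown k<m) = All.lookup {P = _∈ regionH (suc m)}
      (∈-regionH⁺ (down₀ k<m) ∷ ∈-regionH⁺ (down₁ (s<s k<m)) ∷ ∈-regionH⁺ (down₁ (m<n⇒m<1+n k<m))
        ∷ ∈-regionH⁺ (up₁ k<m) ∷ [])

    anchorsH-↭ : anchors (regionH (suc m)) ↭ chainH m
    anchorsH-↭ = anchors-↭ regionH-unique (chainH-unique m)
      (λ c∈ fits → ∈-chainH⁺ m (fits⇒anchor c∈ fits)) (anchor⇒fits ∘ ∈-chainH⁻ m)

    -- Cells and large tiles of `regionP`

    private
      -- Agrees with the filter in `regionP (suc m)` by computation, because `+ suc m ℤ.- 1ℤ`
      -- reduces to `+ m`.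
      kept? : Decidable (_≢ upAnchor m)
      kept? c = ¬? (c ≟ upAnchor m)

    regionP-unique : Unique (regionP (suc m))
    regionP-unique = Unique.filter⁺ kept? regionH-unique

    -- The removed cell occurs exactly once in `regionH (suc m)`, so kept and removed cells together
    -- give its length.
    length-regionP : length (regionP (suc m)) ≡ 4 * m + 1
    length-regionP = suc-injective (begin
      1 + length (regionP (suc m))
        ≡⟨ cong (λ k → k + length (regionP (suc m))) (↭-length removed↭) ⟩
      length (filter (_≟ upAnchor m) (regionH (suc m))) + length (regionP (suc m))
        ≡⟨ length-filter-filter (_≟ upAnchor m) kept? (mk⇔ id id) (regionH (suc m)) ⟩
      length (regionH (suc m))
        ≡⟨ length-regionH ⟩
      4 * m + 2
        ≡⟨ +-suc (4 * m) 1 ⟩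
      1 + (4 * m + 1) ∎)
      where
      open ≡-Reasoning
      removed↭ : upAnchor m ∷ [] ↭ filter (_≟ upAnchor m) (regionH (suc m))
      removed↭ = unique∧set⇒↭ ([] ∷ []) (Unique.filter⁺ (_≟ upAnchor m) regionH-unique) (mk⇔
        (λ { (here refl) → ∈-filter⁺ (_≟ upAnchor m) (∈-regionH⁺ (up₀ (n<1+n m))) refl })
        (λ c∈ → here (proj₂ (∈-filter⁻ (_≟ upAnchor m) {xs = regionH (suc m)} c∈))))

    regionP⊆regionH : regionP (suc m) ⊆ regionH (suc m)
    regionP⊆regionH c∈ = proj₁ (∈-filter⁻ kept? {xs = regionH (suc m)} c∈)

    upAnchor∉regionP : upAnchor m ∉ regionP (suc m)
    upAnchor∉regionP c∈ = proj₂ (∈-filter⁻ kept? {xs = regionH (suc m)} c∈) refl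

    -- For positive `m` the removed cell lies in a single large tile of the full region, as the
    -- second cell of the last up tile. That tile alone is lost.
    anchorsP-↭ : anchors (regionP (suc m)) ↭ chainP m
    anchorsP-↭ = anchors-↭ regionP-unique (chainP-unique m)
      (λ c∈ fits → ∈-chainP⁺ m
        (restrict fits (fits⇒anchor (regionP⊆regionH c∈) (regionP⊆regionH ∘ fits))))
      (λ c∈ v∈ → ∈-filter⁺ kept?
        (anchor⇒fits (Anchor-weaken (m∸n≤m m 1) ≤-refl (∈-chainP⁻ m c∈)) v∈)
        (λ { refl → avoids (∈-chainP⁻ m c∈) v∈ }))
      where
      restrict : ∀ {c} → Fits (regionP (suc m)) c → Anchor m m c → Anchor (m ∸ 1) m c
      restrict fits (isDown k<m) = isDown k<m
      restrict fits (isUp {k} k<m) =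
        -- If `suc k` were `m`, the second cell of the tile would be the removed one.
        isUp (k<m∸1 m k<m λ { refl → upAnchor∉regionP (fits (there (here refl))) })
        where
        k<m∸1 : ∀ m → k < m → suc k ≢ m → k < m ∸ 1
        k<m∸1 (suc m) k<1+m 1+k≢1+m = ≤∧≢⇒< (s≤s⁻¹ k<1+m) (1+k≢1+m ∘ cong suc)
      avoids : ∀ {c} → Anchor (m ∸ 1) m c → upAnchor m ∉ cells (large c)
      avoids (isUp m<m∸1) (here refl) = <⇒≱ m<m∸1 (m∸n≤m m 1)
      -- Here `m` is `suc k`, so the bound `k < m ∸ 1` reads `k < k`.
      avoids (isUp k<k) (there (here refl)) = <-irrefl refl k<k
      avoids (isUp _) (there (there (there (there ()))))
      avoids (isDown _) (there (there (there (here ()))))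

  -- Formulas for `2 * h` and `2 * p` over ℕ

  count-↭ : ∀ {cs ds} → cs ↭ ds → count cs ≡ count ds
  count-↭ = packingSum-↭ (const 1) (λ _ → refl)

  total-↭ : ∀ {cs ds} → cs ↭ ds → total cs ≡ total ds
  total-↭ = packingSum-↭ length ↭-length

  H≡count : ∀ m → H (suc m) ≡ count (chainH m)
  H≡count m = trans (numTilings≡count (regionH-unique m)) (count-↭ (anchorsH-↭ m))

  P≡count : ∀ m → P (suc m) ≡ count (chainP m)
  P≡count m = trans (numTilings≡count (regionP-unique m)) (count-↭ (anchorsP-↭ m))

  h+3total : ∀ m → h (suc m) + 3 * total (chainH m) ≡ (4 * m + 2) * H (suc m)
  h+3total m = begin
    h (suc m) + 3 * total (chainH m)
      ≡⟨ cong (λ t → h (suc m) + 3 * t) (total-↭ (anchorsH-↭ m)) ⟨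
    h (suc m) + 3 * total (anchors (regionH (suc m)))
      ≡⟨ totalTiles+3total (regionH-unique m) ⟩
    length (regionH (suc m)) * count (anchors (regionH (suc m)))
      ≡⟨ cong₂ _*_ (length-regionH m) (sym (numTilings≡count (regionH-unique m))) ⟩
    (4 * m + 2) * H (suc m) ∎
    where open ≡-Reasoning

  p+3total : ∀ m → p (suc m) + 3 * total (chainP m) ≡ (4 * m + 1) * P (suc m)
  p+3total m = begin
    p (suc m) + 3 * total (chainP m)
      ≡⟨ cong (λ t → p (suc m) + 3 * t) (total-↭ (anchorsP-↭ m)) ⟨
    p (suc m) + 3 * total (anchors (regionP (suc m)))
      ≡⟨ totalTiles+3total (regionP-unique m) ⟩
    length (regionP (suc m)) * count (anchors (regionP (suc m)))
      ≡⟨ cong₂ _*_ (length-regionP m) (sym (numTilings≡count (regionP-unique m))) ⟩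
    (4 * m + 1) * P (suc m) ∎
    where open ≡-Reasoning

  -- Eliminates the number `t` of large tiles: `6 * t` is 3 (m + 1) H - 3 P, and 2 (4m + 2) - 3 (m +
  -- 1) = 5m + 1. Adding `6 * t` to both sides keeps the computation in ℕ.
  twice-h : ∀ m → 2 * h (suc m) ≡ (5 * m + 1) * H (suc m) + 3 * P (suc m)
  twice-h m = +-cancelʳ-≡ (6 * t) (2 * h (suc m)) _ (begin
    2 * h (suc m) + 6 * t
      ≡⟨ lemma₁ (h (suc m)) t ⟩
    2 * (h (suc m) + 3 * t)
      ≡⟨ cong (2 *_) (h+3total m) ⟩
    2 * ((4 * m + 2) * H (suc m))
      ≡⟨ lemma₂ m (H (suc m)) ⟩
    (5 * m + 1) * H (suc m) + 3 * (suc m * H (suc m))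
      ≡⟨ cong (λ k → (5 * m + 1) * H (suc m) + 3 * k) twice-total ⟨
    (5 * m + 1) * H (suc m) + 3 * (2 * t + P (suc m))
      ≡⟨ lemma₃ ((5 * m + 1) * H (suc m)) t (P (suc m)) ⟩
    (5 * m + 1) * H (suc m) + 3 * P (suc m) + 6 * t ∎)
    where
    open ≡-Reasoning
    t : ℕ
    t = total (chainH m)
    twice-total : 2 * t + P (suc m) ≡ suc m * H (suc m)
    twice-total = subst₂ (λ a b → 2 * t + a ≡ suc m * b) (sym (P≡count m)) (sym (H≡count m))
                         (proj₂ (total-chain m))
    lemma₁ : ∀ a b → 2 * a + 6 * b ≡ 2 * (a + 3 * b)
    lemma₁ = solve-∀
    lemma₂ : ∀ m a → 2 * ((4 * m + 2) * a) ≡ (5 * m + 1) * a + 3 * ((1 + m) * a)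
    lemma₂ = solve-∀
    lemma₃ : ∀ a b c → a + 3 * (2 * b + c) ≡ a + 3 * c + 6 * b
    lemma₃ = solve-∀

  -- Here `6 * t` is 3 m P, and 2 (4m + 1) - 3m = 5m + 2.
  twice-p : ∀ m → 2 * p (suc m) ≡ (5 * m + 2) * P (suc m)
  twice-p m = +-cancelʳ-≡ (6 * t) (2 * p (suc m)) _ (begin
    2 * p (suc m) + 6 * t
      ≡⟨ lemma₁ (p (suc m)) t ⟩
    2 * (p (suc m) + 3 * t)
      ≡⟨ cong (2 *_) (p+3total m) ⟩
    2 * ((4 * m + 1) * P (suc m))
      ≡⟨ lemma₂ m (P (suc m)) ⟩
    (5 * m + 2) * P (suc m) + 3 * (m * P (suc m))
      ≡⟨ cong (λ k → (5 * m + 2) * P (suc m) + 3 * k) twice-total ⟨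
    (5 * m + 2) * P (suc m) + 3 * (2 * t)
      ≡⟨ lemma₃ ((5 * m + 2) * P (suc m)) t ⟩
    (5 * m + 2) * P (suc m) + 6 * t ∎)
    where
    open ≡-Reasoning
    t : ℕ
    t = total (chainP m)
    twice-total : 2 * t ≡ m * P (suc m)
    twice-total = subst (λ a → 2 * t ≡ m * a) (sym (P≡count m)) (proj₁ (total-chain m))
    lemma₁ : ∀ a b → 2 * a + 6 * b ≡ 2 * (a + 3 * b)
    lemma₁ = solve-∀
    lemma₂ : ∀ m a → 2 * ((4 * m + 1) * a) ≡ (5 * m + 2) * a + 3 * (m * a)
    lemma₂ = solve-∀
    lemma₃ : ∀ a b → a + 3 * (2 * b) ≡ a + 6 * b
    lemma₃ = solve-∀

-- Transfer to the rationals

open import Data.Integer.Base as ℤ using (+_)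
open import Data.Rational.Base using (_/_; _+_; _-_; _*_)

-- Proved through unnormalised fractions, where no greatest common divisor blocks computation. The
-- second argument of `mkℚᵘ` is the denominator minus one.
toℚ-homo-+ : ∀ a b → toℚ (a ℕ.+ b) ≡ toℚ a + toℚ b
toℚ-homo-+ a b = ℚ.toℚᵘ-injective (begin
  toℚᵘ (toℚ (a ℕ.+ b))             ≈⟨ ℚ.toℚᵘ-fromℚᵘ (mkℚᵘ (+ (a ℕ.+ b)) 0) ⟩
  mkℚᵘ (+ (a ℕ.+ b)) 0             ≈⟨ *≡* (cong (ℤ._* + 1) numerator) ⟩
  mkℚᵘ (+ a) 0 ℚᵘ.+ mkℚᵘ (+ b) 0
    ≈⟨ ℚᵘ.+-cong (ℚ.toℚᵘ-fromℚᵘ (mkℚᵘ (+ a) 0)) (ℚ.toℚᵘ-fromℚᵘ (mkℚᵘ (+ b) 0)) ⟨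
  toℚᵘ (toℚ a) ℚᵘ.+ toℚᵘ (toℚ b)   ≈⟨ ℚ.toℚᵘ-homo-+ (toℚ a) (toℚ b) ⟨
  toℚᵘ (toℚ a + toℚ b)             ∎)
  where
  open ℚᵘ.≃-Reasoning
  numerator : + (a ℕ.+ b) ≡ + a ℤ.* + 1 ℤ.+ + b ℤ.* + 1
  numerator = sym (cong₂ ℤ._+_ (ℤ.*-identityʳ (+ a)) (ℤ.*-identityʳ (+ b)))

toℚ-homo-* : ∀ a b → toℚ (a ℕ.* b) ≡ toℚ a * toℚ b
toℚ-homo-* a b = ℚ.toℚᵘ-injective (begin
  toℚᵘ (toℚ (a ℕ.* b))             ≈⟨ ℚ.toℚᵘ-fromℚᵘ (mkℚᵘ (+ (a ℕ.* b)) 0) ⟩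
  mkℚᵘ (+ (a ℕ.* b)) 0             ≈⟨ *≡* (cong (ℤ._* + 1) (ℤ.pos-* a b)) ⟩
  mkℚᵘ (+ a) 0 ℚᵘ.* mkℚᵘ (+ b) 0
    ≈⟨ ℚᵘ.*-cong (ℚ.toℚᵘ-fromℚᵘ (mkℚᵘ (+ a) 0)) (ℚ.toℚᵘ-fromℚᵘ (mkℚᵘ (+ b) 0)) ⟨
  toℚᵘ (toℚ a) ℚᵘ.* toℚᵘ (toℚ b)   ≈⟨ ℚ.toℚᵘ-homo-* (toℚ a) (toℚ b) ⟨
  toℚᵘ (toℚ a * toℚ b)             ∎)
  where open ℚᵘ.≃-Reasoning

toℚ-half : ∀ a b → 2 ℕ.* a ≡ b → toℚ a ≡ (+ 1 / 2) * toℚ b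
toℚ-half a b 2a≡b = begin
  -- The closed product `(+ 1 / 2) * toℚ 2` evaluates to one.
  toℚ a                          ≡⟨ ℚ.*-identityˡ (toℚ a) ⟨
  (+ 1 / 2) * toℚ 2 * toℚ a      ≡⟨ ℚ.*-assoc (+ 1 / 2) (toℚ 2) (toℚ a) ⟩
  (+ 1 / 2) * (toℚ 2 * toℚ a)    ≡⟨ cong ((+ 1 / 2) *_) (toℚ-homo-* 2 a) ⟨
  (+ 1 / 2) * toℚ (2 ℕ.* a)      ≡⟨ cong (λ k → (+ 1 / 2) * toℚ k) 2a≡b ⟩
  (+ 1 / 2) * toℚ b              ∎
  where open ≡-Reasoning

-- With n = m + 1, the coefficient (5m + 1) / 2 is 5n / 2 - 2.
half-identity-H : ∀ m a b → (+ 1 / 2) * toℚ ((5 ℕ.* m ℕ.+ 1) ℕ.* a ℕ.+ 3 ℕ.* b) ≡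
  (+ 5 / 2) * toℚ (suc m) * toℚ a + (+ 3 / 2) * toℚ b - toℚ 2 * toℚ a
half-identity-H m a b
  rewrite toℚ-homo-+ ((5 ℕ.* m ℕ.+ 1) ℕ.* a) (3 ℕ.* b) | toℚ-homo-* (5 ℕ.* m ℕ.+ 1) a
        | toℚ-homo-+ (5 ℕ.* m) 1 | toℚ-homo-* 5 m | toℚ-homo-* 3 b | toℚ-homo-+ 1 m
  = solve 3 (λ x y z →
      con (+ 1 / 2) :* ((con (toℚ 5) :* x :+ con (toℚ 1)) :* y :+ con (toℚ 3) :* z)
      := con (+ 5 / 2) :* (con (toℚ 1) :+ x) :* y :+ con (+ 3 / 2) :* z :- con (toℚ 2) :* y)
      refl (toℚ m) (toℚ a) (toℚ b)
  where open +-*-Solver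

-- With n = m + 1, the coefficient (5m + 2) / 2 is 5n / 2 - 3 / 2.
half-identity-P : ∀ m a → (+ 1 / 2) * toℚ ((5 ℕ.* m ℕ.+ 2) ℕ.* a) ≡
  (+ 5 / 2) * toℚ (suc m) * toℚ a - (+ 3 / 2) * toℚ a
half-identity-P m a
  rewrite toℚ-homo-* (5 ℕ.* m ℕ.+ 2) a
        | toℚ-homo-+ (5 ℕ.* m) 2 | toℚ-homo-* 5 m | toℚ-homo-+ 1 m
  = solve 2 (λ x y →
      con (+ 1 / 2) :* ((con (toℚ 5) :* x :+ con (toℚ 2)) :* y)
      := con (+ 5 / 2) :* (con (toℚ 1) :+ x) :* y :- con (+ 3 / 2) :* y)
      refl (toℚ m) (toℚ a)
  where open +-*-Solver

half-numerator : ∀ m → (+ 5 ℤ.* + suc m ℤ.- + 3) / 2 ≡ (+ 1 / 2) * toℚ (5 ℕ.* m ℕ.+ 2)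
half-numerator m = ℚ.toℚᵘ-injective (begin
  toℚᵘ ((+ 5 ℤ.* + suc m ℤ.- + 3) / 2)      ≈⟨ ℚ.toℚᵘ-fromℚᵘ (mkℚᵘ (+ 5 ℤ.* + suc m ℤ.- + 3) 1) ⟩
  mkℚᵘ (+ 5 ℤ.* + suc m ℤ.- + 3) 1          ≈⟨ *≡* (cong (ℤ._* + 2) numerator) ⟩
  mkℚᵘ (+ 1) 1 ℚᵘ.* mkℚᵘ (+ (5 ℕ.* m ℕ.+ 2)) 0
    ≈⟨ ℚᵘ.*-congˡ {mkℚᵘ (+ 1) 1} (ℚ.toℚᵘ-fromℚᵘ (mkℚᵘ (+ (5 ℕ.* m ℕ.+ 2)) 0)) ⟨
  toℚᵘ (+ 1 / 2) ℚᵘ.* toℚᵘ (toℚ (5 ℕ.* m ℕ.+ 2))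
    ≈⟨ ℚ.toℚᵘ-homo-* (+ 1 / 2) (toℚ (5 ℕ.* m ℕ.+ 2)) ⟨
  toℚᵘ ((+ 1 / 2) * toℚ (5 ℕ.* m ℕ.+ 2))    ∎)
  where
  open ℚᵘ.≃-Reasoning
  lemma : ∀ m → 5 ℕ.* (1 ℕ.+ m) ≡ 3 ℕ.+ (5 ℕ.* m ℕ.+ 2)
  lemma = solve-∀
  numerator : + 5 ℤ.* + suc m ℤ.- + 3 ≡ + 1 ℤ.* + (5 ℕ.* m ℕ.+ 2)
  -- After `lemma` exposes the summand 3, the integer subtraction cancels by computation.
  numerator = trans (cong (λ k → + k ℤ.- + 3) (lemma m)) (sym (ℤ.*-identityˡ (+ (5 ℕ.* m ℕ.+ 2))))

theorem6 : (n : ℕ) → n ≥ 1 →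
    (toℚ (h n) ≡ (+ 5 / 2) * toℚ n * toℚ (H n) + (+ 3 / 2) * toℚ (P n) - toℚ 2 * toℚ (H n))
    × (toℚ (p n) ≡ (+ 5 / 2) * toℚ n * toℚ (P n) - (+ 3 / 2) * toℚ (P n))
    × ((+ 5 / 2) * toℚ n * toℚ (P n) - (+ 3 / 2) * toℚ (P n)
    ≡ ((+ 5 ℤ.* + n ℤ.- + 3) / 2) * toℚ (P n))
theorem6 (suc m) _ =
    trans (toℚ-half (h (suc m)) _ (twice-h m)) (half-identity-H m (H (suc m)) (P (suc m)))
  , trans (toℚ-half (p (suc m)) _ (twice-p m)) (half-identity-P m (P (suc m)))
  , factor
  where
  open ≡-Reasoning
  factor : (+ 5 / 2) * toℚ (suc m) * toℚ (P (suc m)) - (+ 3 / 2) * toℚ (P (suc m))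
         ≡ ((+ 5 ℤ.* + suc m ℤ.- + 3) / 2) * toℚ (P (suc m))
  factor = begin
    (+ 5 / 2) * toℚ (suc m) * toℚ (P (suc m)) - (+ 3 / 2) * toℚ (P (suc m))
      -- Both forms are compared with half of (5m + 2) P.
      ≡⟨ half-identity-P m (P (suc m)) ⟨
    (+ 1 / 2) * toℚ ((5 ℕ.* m ℕ.+ 2) ℕ.* P (suc m))
      ≡⟨ cong ((+ 1 / 2) *_) (toℚ-homo-* (5 ℕ.* m ℕ.+ 2) (P (suc m))) ⟩
    (+ 1 / 2) * (toℚ (5 ℕ.* m ℕ.+ 2) * toℚ (P (suc m)))
      ≡⟨ ℚ.*-assoc (+ 1 / 2) (toℚ (5 ℕ.* m ℕ.+ 2)) (toℚ (P (suc m))) ⟨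
    (+ 1 / 2) * toℚ (5 ℕ.* m ℕ.+ 2) * toℚ (P (suc m))
      ≡⟨ cong (_* toℚ (P (suc m))) (half-numerator m) ⟨
    ((+ 5 ℤ.* + suc m ℤ.- + 3) / 2) * toℚ (P (suc m)) ∎
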